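{- Let $\mathbb{H}$ be an elementary abelian $2$-hypergroup, the constrained direct product of $\langle q_1\rangle,\dots,\langle q_p\rangle$ with $q_1,\dots,q_p$ involutions of $\mathbb{H}$. Let $\mathbb{G}\subseteq\mathbb{H}$ and let $r$ denote the unique element of $\mathbb{H}$ whose support consists of precisely all thick elements of $\mathbb{H}$ contained in $\{q_1,q_2,\dots,q_p\}$. Then $\mathbb{G}$ is a strongly normal closed subset of $\mathbb{H}$ if and only if $\mathrm{O}^\vartheta(\mathbb{G})=\mathrm{O}^\vartheta(\mathbb{H})=\langle r\rangle$ and there exists $\mathbb{F}\subseteq\mathbb{H}$ such that $\mathbb{F}^\gamma$ is a subgroup of the elementary abelian $2$-group $\mathrm{O}_\vartheta(\mathbb{H})^\gamma$, $\mathbb{G}=\langle r\rangle\mathbb{F}$, $\langle r\rangle\cap\mathbb{F}=\{e\}$, and $\mathrm{O}_\vartheta(\mathbb{G})=\mathbb{F}$.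
   Context: A hypergroup is a nonempty set $\mathbb{H}$ with a hypermultiplication $(a,b)\mapsto ab\subseteq\mathbb{H}$ and a map $a\mapsto a^*$ from $\mathbb{H}$ to $\mathbb{H}$ such that, writing $\mathbb{F}\mathbb{G}=\bigcup_{b\in\mathbb{F},c\in\mathbb{G}}bc$ for $\mathbb{F},\mathbb{G}\subseteq\mathbb{H}$ and $a\mathbb{G}=\{a\}\mathbb{G}$, $\mathbb{G}a=\mathbb{G}\{a\}$: (1) $(ab)c=a(bc)$ for all $a,b,c$; (2) there is a unique $e\in\mathbb{H}$ with $ea=\{a\}=ae$ for all $a$; (3) for all $a,b,c$ the conditions $a\in bc$, $b\in ac^*$, $c\in b^*a$ are pairwise equivalent. A nonempty $\mathbb{G}\subseteq\mathbb{H}$ is a closed subset of $\mathbb{H}$ if $\mathbb{G}^*\mathbb{G}\subseteq\mathbb{G}$, where $\mathbb{G}^*=\{a^*:a\in\mathbb{G}\}$. For $\mathbb{G}\subseteq\mathbb{H}$, $\langle\mathbb{G}\rangle$ is the intersection of all closed subsets of $\mathbb{H}$ containing $\mathbb{G}$, and $\langle a\rangle=\langle\{a\}\rangle$. An element $a$ is thin if $a^*a=\{e\}$ and thick otherwise. $\mathrm{O}_\vartheta(\mathbb{G})$ is the set of thin elements of $\mathbb{H}$ lying in $\mathbb{G}$. For closed subsets $\mathbb{F},\mathbb{G}$: $\mathbb{F}$ is normal in $\mathbb{G}$ if $\mathbb{F}\subseteq\mathbb{G}$ and $\mathbb{F}a=a\mathbb{F}$ for all $a\in\mathbb{G}$;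 $\mathbb{F}$ is a strongly normal closed subset of $\mathbb{G}$ if $a^*\mathbb{F}a\subseteq\mathbb{F}\subseteq\mathbb{G}$ for all $a\in\mathbb{G}$. For $\mathbb{G}\subseteq\mathbb{H}$, $\mathrm{O}^\vartheta(\mathbb{G})$ is the intersection of all strongly normal closed subsets of $\langle\mathbb{G}\rangle$. An involution is an element $a\neq e$ such that $\{e,a\}$ is closed. If $a,b$ are thin, then $ab$ is a singleton $\{c\}$ with $c$ thin. For $\mathbb{G}\subseteq\mathbb{H}$ put $\mathbb{G}^\gamma=\{\{a\}:a\in\mathbb{G}\}$; $\mathrm{O}_\vartheta(\mathbb{H})^\gamma$ carries the binary operation $\{a\}\bullet\{b\}=ab$ with identity $\{e\}$. Elementary abelian $2$-hypergroups: $\mathbb{H}$ is the direct product of normal closed subsets $\mathbb{G}_1,\dots,\mathbb{G}_p$ ($p\geq 1$) if, for each $i$, $\mathbb{H}=\mathbb{G}_i\widehat{\mathbb{G}_i}$ and $\mathbb{G}_i\cap\widehat{\mathbb{G}_i}=\{e\}$, where $\widehat{\mathbb{G}_i}=\prod_{j\neq i}\mathbb{G}_j$ (and $\widehat{\mathbb{G}_1}=\{e\}$ if $p=1$). Then for every $a\in\mathbb{H}$ there are unique $r_i\in\mathbb{G}_i$ ($1\le i\le p$) with $a\in r_1r_2\cdots r_p$; the set $\{r_1,\dots,r_p\}\setminus\{e\}$ is the support of $a$. The direct product is constrained if $r_1r_2\cdots r_p=\{a\}$ for every $a\in\mathbb{H}$. $\mathbb{H}$ is an elementary abelian $2$-hypergroup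 if it is the constrained direct product of closed subsets $\langle q_1\rangle,\dots,\langle q_p\rangle$ with $q_1,\dots,q_p$ involutions of $\mathbb{H}$ (so $\langle q_i\rangle=\{e,q_i\}$); supports are taken with respect to this fixed decomposition. The element with empty support is $e$. -}

module Defs where

open import Level using (Level; Lift; _⊔_) renaming (suc to lsuc)
open import Algebra.Bundles.Raw using (RawMonoid)
open import Algebra.Structures using (IsAbelianGroup)
open import Data.Nat.Base using (ℕ; zero; suc)
open import Data.Product using (Σ; ∃; ∃!; _×_; _,_; proj₁; proj₂)
open import Data.Vec.Functional using (Vector; head; tail; map; removeAt)
open import Function.Bundles using (_⇔_; Equivalence)
open import Relation.Binary.PropositionalEquality
  using (_≡_; _≢_; refl; sym; trans; subst)
open import Relation.Nullary using (¬_)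
open import Relation.Unary
  using (Pred; _∈_; _⊆_; _≐_; _∩_; _∪_; U; ｛_｝; Satisfiable; _⊢_)

private
  variable
    c f g ℓ : Level
    n : ℕ

-- Subsets are predicates, compared by `_≐_`.

module ComplexProduct {H : Set ℓ} (_·_ : H → H → Pred H ℓ) where

  infixl 7 _∙_

  _∙_ : Pred H f → Pred H g → Pred H (ℓ ⊔ f ⊔ g)
  (F ∙ G) x = ∃ λ b → ∃ λ d → b ∈ F × d ∈ G × x ∈ b · d

record Hypergroup (ℓ : Level) : Set (lsuc ℓ) where
  infixl 7 _·_
  infix  9 _*

  field
    Carrier : Set ℓ
    _·_     : Carrier → Carrier → Pred Carrier ℓ
    _*      : Carrier → Carrier

  open ComplexProduct _·_ public

  field
    assoc    : ∀ a b c → (a · b) ∙ ｛ c ｝ ≐ ｛ a ｝ ∙ (b · c)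
    identity : ∃! _≡_ λ e → ∀ a → (e · a ≐ ｛ a ｝) × (a · e ≐ ｛ a ｝)
    -- The third pairwise equivalence follows by transitivity.
    exchangeˡ : ∀ a b c → (a ∈ b · c) ⇔ (b ∈ a · c *)
    exchangeʳ : ∀ a b c → (a ∈ b · c) ⇔ (c ∈ b * · a)

  e : Carrier
  e = proj₁ identity

module _ (ℍ : Hypergroup ℓ) where
  open Hypergroup ℍ

  infix 9 _⋆ _^γ

  _⋆ : Pred Carrier g → Pred Carrier (ℓ ⊔ g)
  (G ⋆) x = ∃ λ a → a ∈ G × x ≡ a *

  record IsClosed (G : Pred Carrier g) : Set (ℓ ⊔ g) where
    field
      nonempty : Satisfiable G
      closed   : G ⋆ ∙ G ⊆ G

  -- `Pred Carrier ℓ` is the power set; intersecting over it raises the level.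
  ⟨_⟩ : Pred Carrier g → Pred Carrier (lsuc ℓ ⊔ g)
  ⟨ G ⟩ x = (K : Pred Carrier ℓ) → IsClosed K → G ⊆ K → x ∈ K

  Thin : Pred Carrier ℓ
  Thin a = a * · a ≐ ｛ e ｝

  Thick : Pred Carrier ℓ
  Thick a = ¬ Thin a

  -- Thin elements of the whole hypergroup lying in G.
  O-thin : Pred Carrier g → Pred Carrier (ℓ ⊔ g)
  O-thin G = Thin ∩ G

  record IsNormalIn (F : Pred Carrier f) (G : Pred Carrier g)
    : Set (ℓ ⊔ f ⊔ g) where
    field
      contained : F ⊆ G
      normal    : ∀ {a} → a ∈ G → F ∙ ｛ a ｝ ≐ ｛ a ｝ ∙ F

  record IsStronglyNormalClosedIn (F : Pred Carrier f) (G : Pred Carrier g)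
    : Set (ℓ ⊔ f ⊔ g) where
    field
      isClosed       : IsClosed F
      contained      : F ⊆ G
      stronglyNormal : ∀ {a} → a ∈ G → ｛ a * ｝ ∙ F ∙ ｛ a ｝ ⊆ F

  -- The superscript version, O^ϑ.
  O^ϑ : Pred Carrier g → Pred Carrier (lsuc ℓ ⊔ g)
  O^ϑ G x =
    (K : Pred Carrier ℓ) → IsStronglyNormalClosedIn K ⟨ G ⟩ → x ∈ K

  record IsInvolution (a : Carrier) : Set ℓ where
    field
      a≢e      : a ≢ e
      isClosed : IsClosed (｛ e ｝ ∪ ｛ a ｝)

  -- Ordered product G₁G₂⋯Gₙ; the empty product is {e}.
  ∏ : Vector (Pred Carrier g) n → Pred Carrier (ℓ ⊔ g)
  ∏ {g = g} {n = zero}  G = λ x → Lift g (x ∈ ｛ e ｝)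
  ∏         {n = suc n} G = head G ∙ ∏ (tail G)

  -- The number of factors is `suc n`, i.e. at least one.
  record IsDirectProduct (G : Vector (Pred Carrier g) (suc n))
    : Set (ℓ ⊔ g) where
    field
      isClosed : ∀ i → IsClosed (G i)
      isNormal : ∀ i → IsNormalIn (G i) U
      generate : ∀ i → U ≐ G i ∙ ∏ (removeAt G i)
      disjoint : ∀ i → G i ∩ ∏ (removeAt G i) ≐ ｛ e ｝

  -- a ∈ r₁r₂⋯rₙ with rᵢ ∈ Gᵢ
  record IsDecomposition (G : Vector (Pred Carrier g) n)
    (a : Carrier) (r : Vector Carrier n) : Set (ℓ ⊔ g) where
    field
      component : ∀ i → r i ∈ G i
      product   : a ∈ ∏ (map ｛_｝ r)

  -- In a direct product decompositions exist and are unique, so it makes no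
  -- difference that this quantifies existentially over them while
  -- `IsConstrained` does so universally.
  Support : Vector (Pred Carrier g) n → Carrier → Pred Carrier (ℓ ⊔ g)
  Support G a x =
    ∃ λ r → IsDecomposition G a r × (∃ λ i → x ≡ r i) × x ≢ e

  IsConstrained : Vector (Pred Carrier g) n → Set (ℓ ⊔ g)
  IsConstrained G =
    ∀ a r → IsDecomposition G a r → ∏ (map ｛_｝ r) ≐ ｛ a ｝

  generated : Vector Carrier n → Vector (Pred Carrier (lsuc ℓ)) n
  generated q i = ⟨ ｛ q i ｝ ⟩

  record IsElementaryAbelian2Hypergroup (q : Vector Carrier (suc n))
    : Set (lsuc ℓ) where
    field
      isInvolution    : ∀ i → IsInvolution (q i)
      isDirectProduct : IsDirectProduct (generated q)
      isConstrained   : IsConstrained (generated q)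

  _^γ : Pred Carrier ℓ → Pred (Pred Carrier ℓ) ℓ
  (G ^γ) S = ∃ λ a → a ∈ G × S ≐ ｛ a ｝

  module ThinProducts where
    cancel : ∀ {a b x y} → Thin a → Thin b → x ∈ a · b → y ∈ a · b →
             x * · y ⊆ ｛ e ｝
    cancel {a} {b} {x} {y} a-thin b-thin x∈ab y∈ab {z} z∈x*y =
      proj₁ b-thin z∈b*b
      where
      open Equivalence

      x*∈b*a* : x * ∈ b * · a *
      x*∈b*a* = exchangeʳ _ _ _ .to
        (exchangeˡ _ _ _ .to (exchangeʳ _ _ _ .to x∈ab))

      z∈b*b : z ∈ b * · b
      z∈b*b with proj₂ (assoc (x *) a b) (_ , _ , refl , y∈ab , z∈x*y)
      ... | w , _ , w∈x*a , refl , z∈wb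
        with proj₁ (assoc (b *) (a *) a) (_ , _ , x*∈b*a* , refl , w∈x*a)
      ... | _ , v , refl , v∈a*a , w∈b*v
        with proj₁ a-thin v∈a*a
      ... | refl with proj₁ (proj₂ (proj₁ (proj₂ identity) (b *))) w∈b*v
      ... | refl = z∈wb

    e-identityˡ : ∀ a → e · a ≐ ｛ a ｝
    e-identityˡ a = proj₁ (proj₁ (proj₂ identity) a)

    e-identityʳ : ∀ a → a · e ≐ ｛ a ｝
    e-identityʳ a = proj₂ (proj₁ (proj₂ identity) a)

    e∈a*a : ∀ a → e ∈ a * · a
    e∈a*a a = Equivalence.to (exchangeʳ _ _ _) (proj₂ (e-identityʳ a) refl)

    e∈aa* : ∀ a → e ∈ a · a *
    e∈aa* a = Equivalence.to (exchangeˡ _ _ _) (proj₂ (e-identityˡ a) refl)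

    a**≡a : ∀ a → a * * ≡ a
    a**≡a a = proj₁ (e-identityˡ _) (Equivalence.to (exchangeˡ _ _ _) (e∈aa* a))

    e*≡e : e * ≡ e
    e*≡e = proj₁ (e-identityˡ (e *)) (e∈aa* e)

    e-thin : Thin e
    e-thin = subst (λ x → x · e ≐ ｛ e ｝) (sym e*≡e) (e-identityˡ e)

    ·-nonempty : ∀ a b → Satisfiable (a · b)
    ·-nonempty a b
      with proj₂ (assoc a b (b *))
             (_ , _ , refl , e∈aa* b , proj₂ (e-identityʳ a) refl)
    ... | x , _ , x∈ab , _ = x , x∈ab

    ·-unique : ∀ {a b x y} → Thin a → Thin b → x ∈ a · b → y ∈ a · b → x ≡ y
    ·-unique {x = x} {y} a-thin b-thin x∈ab y∈ab
      with ·-nonempty (x *) y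
    ... | z , z∈x*y with cancel a-thin b-thin x∈ab y∈ab z∈x*y
    ... | refl = trans (sym (a**≡a x))
      (proj₁ (e-identityʳ _) (Equivalence.to (exchangeʳ _ _ _) z∈x*y))

    •-closed : ∀ {S T} → S ∈ O-thin U ^γ → T ∈ O-thin U ^γ →
               S ∙ T ∈ O-thin U ^γ
    •-closed (a , (a-thin , _) , S≐a) (b , (b-thin , _) , T≐b)
      with ·-nonempty a b
    ... | x , x∈ab =
      x , ( ( cancel a-thin b-thin x∈ab x∈ab
            , λ { refl → e∈a*a x })
          , _ )
        , ( (λ { (s , t , s∈S , t∈T , y∈st) →
                 unique (proj₁ S≐a s∈S) (proj₁ T≐b t∈T) y∈st })
          , λ { refl → a , b , proj₂ S≐a refl , proj₂ T≐b refl , x∈ab } )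
      where
      unique : ∀ {s t y} → a ≡ s → b ≡ t → y ∈ s · t → x ≡ y
      unique refl refl = ·-unique a-thin b-thin x∈ab

  open ThinProducts using (e-thin; •-closed)

  -- The set of singletons of thin elements, with {a} • {b} = ab: on singletons
  -- the complex product {a}{b} is the hyperproduct ab.
  thinγ : RawMonoid (lsuc ℓ) ℓ
  thinγ = record
    { Carrier = Σ (Pred Carrier ℓ) (O-thin U ^γ)
    ; _≈_     = λ S T → proj₁ S ≐ proj₁ T
    ; _∙_     = λ S T → proj₁ S ∙ proj₁ T , •-closed (proj₂ S) (proj₂ T)
    ; ε       = ｛ e ｝ , e , (e-thin , _) , (λ x → x) , (λ x → x)
    }

module _ (M : RawMonoid c ℓ) where
  open RawMonoid M renaming (_∙_ to _•_)

  record IsElementaryAbelian2Group : Set (c ⊔ ℓ) where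
    field
      inverse        : Carrier → Carrier
      isAbelianGroup : IsAbelianGroup _≈_ _•_ ε inverse
      exponent       : ∀ x → (x • x) ≈ ε

  record IsSubgroup (P : Pred Carrier g) : Set (c ⊔ ℓ ⊔ g) where
    field
      ε∈       : ε ∈ P
      •-closed : ∀ {x y} → x ∈ P → y ∈ P → (x • y) ∈ P
      inverse  : ∀ {x} → x ∈ P →
                 ∃ λ y → y ∈ P × ((x • y) ≈ ε) × ((y • x) ≈ ε)

-- F^γ is a subgroup of O_ϑ(ℍ)^γ.
record IsThinSubgroup (ℍ : Hypergroup ℓ) (F : Pred (Hypergroup.Carrier ℍ) ℓ)
  : Set (lsuc ℓ) where
  field
    contained  : _^γ ℍ F ⊆ _^γ ℍ (O-thin ℍ U)
    isSubgroup : IsSubgroup (thinγ ℍ) (proj₁ ⊢ _^γ ℍ F)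

-- The involutions commute pairwise, so each element, being the product of its
-- components, is its own inverse; hence complex multiplication is commutative
-- and x = ∏ vᵢ gives xx = ∏ vᵢvᵢ. For thick qᵢ one has qᵢqᵢ = {e , qᵢ}, while
-- qᵢqᵢ = {e} for thin qᵢ. Therefore rr is closed, equals ⟨r⟩, contains aa for
-- every a, and meets the thin elements only in e. Since a*Ka = (aa)K, a closed
-- set is strongly normal exactly when it contains rr, and as every element lies
-- in rr·Thin, such a set is rr times its thin part.
module Submission where

open import Defs
open import Level using (Level; lift) renaming (suc to lsuc)
open import Algebra.Bundles using (Monoid; CommutativeMonoid)
open import Algebra.Bundles.Raw using (RawMonoid)
import Algebra.Properties.CommutativeSemigroup as CommutativeSemigroupProperties
open import Axiom.ExcludedMiddle using (ExcludedMiddle)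
open import Data.Empty using (⊥-elim)
open import Data.Fin.Base using (zero; suc)
open import Data.Nat.Base using (ℕ; zero; suc)
open import Data.Product using (∃; _×_; _,_; proj₁; proj₂)
open import Data.Sum.Base using (inj₁; inj₂)
open import Data.Vec.Functional using (Vector; map; _∷_)
open import Function.Base using (id; _∘_)
open import Function.Bundles using (_⇔_; mk⇔; Equivalence)
open import Relation.Binary.PropositionalEquality using (_≡_; _≢_; refl; sym; subst)
open import Relation.Nullary using (yes; no)
open import Relation.Unary using (Pred; _∈_; _⊆_; _≐_; _∩_; _∪_; U; ｛_｝)
open import Relation.Unary.Properties using (≐-refl; ≐-sym; ≐-trans)
open import Relation.Unary.Relation.Binary.Equality using (≐-isEquivalence)

private
  variable
    f g h k ℓ : Level
    n : ℕ

-- Complex products and ordered products in an arbitrary hypergroup.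

module HypergroupProperties (ℍ : Hypergroup ℓ) where
  open Hypergroup ℍ
  open ThinProducts ℍ
  open Equivalence

  *-anti : ∀ {a b x} → x ∈ a · b → x * ∈ b * · a *
  *-anti x∈ab = exchangeʳ _ _ _ .to (exchangeˡ _ _ _ .to (exchangeʳ _ _ _ .to x∈ab))

  ∙-mono : {F : Pred Carrier f} {G : Pred Carrier g}
           {F′ : Pred Carrier h} {G′ : Pred Carrier k} →
           F ⊆ F′ → G ⊆ G′ → F ∙ G ⊆ F′ ∙ G′
  ∙-mono F⊆F′ G⊆G′ (b , d , b∈F , d∈G , x∈bd) = b , d , F⊆F′ b∈F , G⊆G′ d∈G , x∈bd

  ∙-assoc : (F : Pred Carrier f) (G : Pred Carrier g) (K : Pred Carrier k) →
            (F ∙ G) ∙ K ≐ F ∙ (G ∙ K)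
  ∙-assoc F G K = to′ , from′
    where
    to′ : (F ∙ G) ∙ K ⊆ F ∙ (G ∙ K)
    to′ (y , c , (a , b , a∈F , b∈G , y∈ab) , c∈K , x∈yc)
      with proj₁ (assoc a b c) (y , c , y∈ab , refl , x∈yc)
    ... | _ , w , refl , w∈bc , x∈aw = a , w , a∈F , (b , c , b∈G , c∈K , w∈bc) , x∈aw

    from′ : F ∙ (G ∙ K) ⊆ (F ∙ G) ∙ K
    from′ (a , w , a∈F , (b , c , b∈G , c∈K , w∈bc) , x∈aw)
      with proj₂ (assoc a b c) (a , w , refl , w∈bc , x∈aw)
    ... | y , _ , y∈ab , refl , x∈yc = y , c , (a , b , a∈F , b∈G , y∈ab) , c∈K , x∈yc

  ∙-identityˡ : (F : Pred Carrier f) → ｛ e ｝ ∙ F ≐ F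
  ∙-identityˡ F =
      (λ { (_ , d , refl , d∈F , x∈ed) → subst F (proj₁ (e-identityˡ d) x∈ed) d∈F })
    , λ {x} x∈F → e , x , refl , x∈F , proj₂ (e-identityˡ x) refl

  ∙-identityʳ : (F : Pred Carrier f) → F ∙ ｛ e ｝ ≐ F
  ∙-identityʳ F =
      (λ { (b , _ , b∈F , refl , x∈be) → subst F (proj₁ (e-identityʳ b) x∈be) b∈F })
    , λ {x} x∈F → x , e , x∈F , refl , proj₂ (e-identityʳ x) refl

  ｛a｝∙｛b｝≐ab : ∀ a b → ｛ a ｝ ∙ ｛ b ｝ ≐ a · b
  ｛a｝∙｛b｝≐ab a b = (λ { (_ , _ , refl , refl , x∈ab) → x∈ab })
                , λ x∈ab → a , b , refl , refl , x∈ab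

  ∙-monoid : Monoid (lsuc ℓ) ℓ
  ∙-monoid = record
    { Carrier = Pred Carrier ℓ
    ; _≈_ = _≐_
    ; _∙_ = _∙_
    ; ε = ｛ e ｝
    ; isMonoid = record
      { isSemigroup = record
        { isMagma = record
          { isEquivalence = ≐-isEquivalence
          ; ∙-cong = λ F≐F′ G≐G′ → ∙-mono (proj₁ F≐F′) (proj₁ G≐G′)
                                 , ∙-mono (proj₂ F≐F′) (proj₂ G≐G′)
          }
        ; assoc = ∙-assoc
        }
      ; identity = ∙-identityˡ , ∙-identityʳ
      }
    }

  ∏-mono : {F : Vector (Pred Carrier f) n} {G : Vector (Pred Carrier g) n} →
           (∀ i → F i ⊆ G i) → ∏ ℍ F ⊆ ∏ ℍ G
  ∏-mono {n = zero}  F⊆G (lift x≡e) = lift x≡e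
  ∏-mono {n = suc n} F⊆G = ∙-mono (F⊆G zero) (∏-mono (F⊆G ∘ suc))

  -- Serves as an induction principle: a property of `e` that survives hyperproducts passes from the
  -- factors to the whole ordered product.
  ∏-closed : {F : Vector (Pred Carrier f) n} {K : Pred Carrier k} →
             e ∈ K → K ∙ K ⊆ K → (∀ i → F i ⊆ K) → ∏ ℍ F ⊆ K
  ∏-closed {n = zero}  e∈K KK⊆K F⊆K (lift refl) = e∈K
  ∏-closed {n = suc n} e∈K KK⊆K F⊆K x∈∏F =
    KK⊆K (∙-mono (F⊆K zero) (∏-closed e∈K KK⊆K (F⊆K ∘ suc)) x∈∏F)

  e∈∏ : {F : Vector (Pred Carrier f) n} → (∀ i → e ∈ F i) → e ∈ ∏ ℍ F
  e∈∏ {n = zero}  e∈F = lift refl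
  e∈∏ {n = suc n} e∈F = e , e , e∈F zero , e∈∏ (e∈F ∘ suc) , proj₂ (e-identityˡ e) refl

  factor⊆∏ : {F : Vector (Pred Carrier f) n} → (∀ i → e ∈ F i) → ∀ i → F i ⊆ ∏ ℍ F
  factor⊆∏ e∈F zero    {x} x∈F =
    x , e , x∈F , e∈∏ (e∈F ∘ suc) , proj₂ (e-identityʳ x) refl
  factor⊆∏ e∈F (suc i) {x} x∈F =
    e , x , e∈F zero , factor⊆∏ (e∈F ∘ suc) i x∈F , proj₂ (e-identityˡ x) refl

  -- Supplies decompositions both along the `⟨ ｛ q i ｝ ⟩` and along smaller factors such as
  -- `v i · v i`.
  ∏-select : {F : Vector (Pred Carrier f) n} {x : Carrier} → x ∈ ∏ ℍ F →
             ∃ λ v → IsDecomposition ℍ F x v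
  ∏-select {n = zero}  (lift x≡e) =
    (λ ()) , record { component = λ () ; product = lift x≡e }
  ∏-select {n = suc n} {F} (b , y , b∈F , y∈∏F , x∈by) with ∏-select y∈∏F
  ... | v , d = b ∷ v , record
    { component = λ { zero → b∈F ; (suc i) → IsDecomposition.component d i }
    ; product   = b , y , refl , IsDecomposition.product d , x∈by
    }

  -- `K` moves left past one factor at a time: first past the tail by induction, then past the head.
  ∏-slide : {F : Vector (Pred Carrier f) n} {K : Pred Carrier k} →
            (∀ i → F i ∙ K ⊆ K ∙ F i) → ∏ ℍ F ∙ K ⊆ K ∙ ∏ ℍ F
  ∏-slide {n = zero} FK⊆KF (_ , d , lift refl , d∈K , x∈ed) with proj₁ (e-identityˡ d) x∈ed
  ... | refl = d , e , d∈K , lift refl , proj₂ (e-identityʳ d) refl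
  ∏-slide {n = suc n} {F = F} {K} FK⊆KF =
      proj₁ (∙-assoc K _ _)
    ∘ ∙-mono (FK⊆KF zero) id
    ∘ proj₂ (∙-assoc (F zero) K _)
    ∘ ∙-mono id (∏-slide (FK⊆KF ∘ suc))
    ∘ proj₁ (∙-assoc (F zero) _ K)

  -- Inversion reverses the order of the factors, and commutation restores it by sliding `v zero`
  -- back to the front.
  ∏-self-inverse : {v : Vector Carrier n} →
    (∀ i → v i * ≡ v i) → (∀ i j → v i · v j ⊆ v j · v i) →
    ∀ {x} → x ∈ ∏ ℍ (map ｛_｝ v) → x * ∈ ∏ ℍ (map ｛_｝ v)
  ∏-self-inverse {n = zero} v*≡v comm (lift refl) = lift (sym e*≡e)
  ∏-self-inverse {n = suc n} {v} v*≡v comm (_ , y , refl , y∈∏v , x∈v₀y) =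
    ∏-slide {F = map ｛_｝ (v ∘ suc)} (λ { i (_ , _ , refl , refl , z∈) →
        v zero , v (suc i) , refl , refl , comm (suc i) zero z∈ })
      ( y * , v zero
      , ∏-self-inverse {v = v ∘ suc} (v*≡v ∘ suc) (λ i j → comm (suc i) (suc j)) y∈∏v , refl
      , subst (λ a → _ ∈ y * · a) (v*≡v zero) (*-anti x∈v₀y))

  -- Closed subsets and involutions.

  module Closed {K : Pred Carrier k} (K-closed : IsClosed ℍ K) where
    open IsClosed K-closed

    e∈ : e ∈ K
    e∈ = let a , a∈K = nonempty in
      closed (a * , a , (a , a∈K , refl) , a∈K , e∈a*a a)

    *∈ : ∀ {a} → a ∈ K → a * ∈ K
    *∈ {a} a∈K = closed (a * , e , (a , a∈K , refl) , e∈ , proj₂ (e-identityʳ (a *)) refl)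

    ∙⊆ : K ∙ K ⊆ K
    ∙⊆ (a , b , a∈K , b∈K , x∈ab) =
      closed (a , b , (a * , *∈ a∈K , sym (a**≡a a)) , b∈K , x∈ab)

  ⟨⟩-closed : (X : Pred Carrier g) → IsClosed ℍ (⟨_⟩ ℍ X)
  ⟨⟩-closed X = record
    { nonempty = e , λ K K-closed _ → Closed.e∈ K-closed
    ; closed = λ { (_ , b , (a , a∈X , refl) , b∈X , x∈a*b) K K-closed X⊆K →
        Closed.∙⊆ K-closed
          (a * , b , Closed.*∈ K-closed (a∈X K K-closed X⊆K) , b∈X K K-closed X⊆K , x∈a*b) }
    }

  -- In a closed set {e , a} the element a* can only be e or a, and a* = e forces a = e.
  involution-self-inverse : ∀ {a} → IsInvolution ℍ a → a * ≡ a
  involution-self-inverse {a} a-inv with Closed.*∈ (IsInvolution.isClosed a-inv) (inj₂ refl)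
  ... | inj₂ a≡a* = sym a≡a*
  ... | inj₁ e≡a* with a**≡a a
  ...   | a**≡a′ rewrite sym e≡a* | e*≡e = a**≡a′

  ⟨involution⟩ : ∀ {a} → IsInvolution ℍ a → ⟨_⟩ ℍ ｛ a ｝ ≐ ｛ e ｝ ∪ ｛ a ｝
  ⟨involution⟩ a-inv =
      (λ x∈ → x∈ _ (IsInvolution.isClosed a-inv) inj₂)
    , λ { (inj₁ refl) K K-closed _ → Closed.e∈ K-closed ; (inj₂ refl) K _ a⊆K → a⊆K refl }

  -- Normality only gives {b} ∪ ab = {b} ∪ ba, but b ∈ ab would force a ∈ bb* ⊆ {e , b}.
  involutions-commute : ∀ {a b} → IsInvolution ℍ a → IsInvolution ℍ b →
    IsNormalIn ℍ (⟨_⟩ ℍ ｛ a ｝) U → a · b ⊆ b · a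
  involutions-commute {a} {b} a-inv b-inv a-normal {x} x∈ab
    with proj₁ (IsNormalIn.normal a-normal {b} _)
           (a , b , proj₂ (⟨involution⟩ a-inv) (inj₂ refl) , refl , x∈ab)
  ... | _ , c , refl , c∈⟨a⟩ , x∈bc with proj₁ (⟨involution⟩ a-inv) c∈⟨a⟩
  ...   | inj₂ refl = x∈bc
  ...   | inj₁ refl with proj₁ (e-identityʳ b) x∈bc
  ...     | refl with Closed.∙⊆ (IsInvolution.isClosed b-inv)
                      (b , b * , inj₂ refl , inj₂ (sym (involution-self-inverse b-inv))
                      , exchangeˡ _ _ _ .to x∈ab)
  ...       | inj₁ e≡a  = ⊥-elim (IsInvolution.a≢e a-inv (sym e≡a))
  ...       | inj₂ refl = x∈ab

-- Hypergroups in which every element is its own inverse.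

module SelfInverse (ℍ : Hypergroup ℓ) (*-id : ∀ a → Hypergroup._* ℍ a ≡ a) where
  open Hypergroup ℍ
  open ThinProducts ℍ
  open HypergroupProperties ℍ
  open Equivalence

  -- Inversion reverses hyperproducts and here fixes every element.
  ·-comm : ∀ {a b} → a · b ⊆ b · a
  ·-comm {a} {b} {x} x∈ab with *-anti x∈ab
  ... | x*∈b*a* rewrite *-id a | *-id b | *-id x = x*∈b*a*

  ∙-comm : (F : Pred Carrier f) (G : Pred Carrier g) → F ∙ G ≐ G ∙ F
  ∙-comm F G = swap , swap
    where
    swap : {F : Pred Carrier f} {G : Pred Carrier g} → F ∙ G ⊆ G ∙ F
    swap (b , d , b∈F , d∈G , x∈bd) = d , b , d∈G , b∈F , ·-comm x∈bd

  ∙-commutativeMonoid : CommutativeMonoid (lsuc ℓ) ℓ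
  ∙-commutativeMonoid = record
    { isCommutativeMonoid = record
      { isMonoid = Monoid.isMonoid ∙-monoid
      ; comm = ∙-comm
      }
    }

  open CommutativeSemigroupProperties
    (CommutativeMonoid.commutativeSemigroup ∙-commutativeMonoid) public
    using () renaming (interchange to ∙-interchange)

  -- Repeated interchange of the inner factors; it allows squares of products to be computed
  -- componentwise.
  ∏-distrib-∙ : (F G : Vector (Pred Carrier ℓ) n) →
                ∏ ℍ (λ i → F i ∙ G i) ≐ ∏ ℍ F ∙ ∏ ℍ G
  ∏-distrib-∙ {n = zero} F G =
      (λ { (lift refl) → e , e , lift refl , lift refl , proj₂ (e-identityˡ e) refl })
    , λ { (_ , _ , lift refl , lift refl , x∈ee) → lift (proj₁ (e-identityˡ e) x∈ee) }
  ∏-distrib-∙ {n = suc n} F G =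
    ≐-trans (CommutativeMonoid.∙-congˡ ∙-commutativeMonoid (∏-distrib-∙ (F ∘ suc) (G ∘ suc)))
            (∙-interchange (F zero) (G zero) _ _)

  thin-square : ∀ {a} → Thin ℍ a → a · a ≐ ｛ e ｝
  thin-square {a} = subst (λ b → b · a ≐ ｛ e ｝) (*-id a)

  square-thin : ∀ {a} → a · a ≐ ｛ e ｝ → Thin ℍ a
  square-thin {a} = subst (λ b → b · a ≐ ｛ e ｝) (sym (*-id a))

  e∈square : ∀ a → e ∈ a · a
  e∈square a = subst (λ b → e ∈ b · a) (*-id a) (e∈a*a a)

  thin-∙⊆ : Thin ℍ ∙ Thin ℍ ⊆ Thin ℍ
  thin-∙⊆ (a , b , a-thin , b-thin , x∈ab) =
    cancel a-thin b-thin x∈ab x∈ab , λ { refl → e∈a*a _ }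

  closed-if : {K : Pred Carrier k} → e ∈ K → K ∙ K ⊆ K → IsClosed ℍ K
  closed-if {K = K} e∈K KK⊆K = record
    { nonempty = e , e∈K
    ; closed = KK⊆K ∘ ∙-mono (λ { (a , a∈K , refl) → subst K (sym (*-id a)) a∈K }) id
    }

  -- A thin `a` satisfies `a · a ≐ ｛ e ｝`, so each singleton is its own group inverse.
  thinγ-elementary : IsElementaryAbelian2Group (thinγ ℍ)
  thinγ-elementary = record
    { inverse = id
    ; isAbelianGroup = record
      { isGroup = record
        { isMonoid = record
          { isSemigroup = record
            { isMagma = record
              { isEquivalence = record { refl = ≐-refl ; sym = ≐-sym ; trans = ≐-trans }
              ; ∙-cong = ∙-cong
              }
            ; assoc = λ S T V → ∙-assoc (proj₁ S) (proj₁ T) (proj₁ V)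
            }
          ; identity = (λ S → ∙-identityˡ (proj₁ S)) , λ S → ∙-identityʳ (proj₁ S)
          }
        ; inverse = exponent , exponent
        ; ⁻¹-cong = id
        }
      ; comm = λ S T → ∙-comm (proj₁ S) (proj₁ T)
      }
    ; exponent = exponent
    }
    where
    open CommutativeMonoid ∙-commutativeMonoid using (∙-cong)

    exponent : ∀ S → proj₁ S ∙ proj₁ S ≐ ｛ e ｝
    exponent (S , a , (a-thin , _) , S≐a) = ≐-trans (∙-cong S≐a S≐a)
      ( (λ { (_ , _ , refl , refl , x∈aa) → proj₁ (thin-square a-thin) x∈aa })
      , λ x∈e → a , a , refl , refl , proj₂ (thin-square a-thin) x∈e )

  module _ {K : Pred Carrier k} {X : Pred Carrier g}
           (K-sn : IsStronglyNormalClosedIn ℍ K X) where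
    open IsStronglyNormalClosedIn K-sn

    -- Insert `e ∈ K` in the middle: `aa = a*ea ⊆ a*Ka ⊆ K`.
    square⊆stronglyNormal : ∀ {a} → a ∈ X → a · a ⊆ K
    square⊆stronglyNormal {a} a∈X x∈aa = stronglyNormal a∈X
      ( a * , a , (a * , e , refl , Closed.e∈ isClosed , proj₂ (e-identityʳ _) refl) , refl
      , subst (λ b → _ ∈ b · a) (sym (*-id a)) x∈aa )

  -- By commutativity `a*Ka = K(a*a) = K(aa)`, which lies in `KK ⊆ K`.
  stronglyNormal-if : {K : Pred Carrier k} {X : Pred Carrier g} →
    IsClosed ℍ K → K ⊆ X → (∀ {a} → a ∈ X → a · a ⊆ K) → IsStronglyNormalClosedIn ℍ K X
  stronglyNormal-if {K = K} {X} K-closed K⊆X square⊆K = record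
    { isClosed = K-closed
    ; contained = K⊆X
    ; stronglyNormal = λ a∈X →
          Closed.∙⊆ K-closed
        ∘ ∙-mono id (λ { (_ , _ , refl , refl , x∈) →
            square⊆K a∈X (subst (λ b → _ ∈ b · _) (*-id _) x∈) })
        ∘ proj₁ (∙-assoc K _ _)
        ∘ ∙-mono (proj₁ (∙-comm _ K)) id
    }

  thinSubgroup : {G : Pred Carrier ℓ} → IsClosed ℍ G → IsThinSubgroup ℍ (O-thin ℍ G)
  thinSubgroup {G} G-closed = record
    { contained = λ { (a , (a-thin , _) , S≐a) → a , (a-thin , _) , S≐a }
    ; isSubgroup = record
      { ε∈ = e , (e-thin , Closed.e∈ G-closed) , ≐-refl
      ; •-closed = λ { {S} {T} → closed S T }
      ; inverse = λ {S} S∈ → S , S∈ , exponent S , exponent S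
      }
    }
    where
    open IsElementaryAbelian2Group thinγ-elementary using (exponent)

    closed : ∀ S T → proj₁ S ∈ _^γ ℍ (O-thin ℍ G) → proj₁ T ∈ _^γ ℍ (O-thin ℍ G) →
             proj₁ S ∙ proj₁ T ∈ _^γ ℍ (O-thin ℍ G)
    closed S T (a , (_ , a∈G) , S≐a) (b , (_ , b∈G) , T≐b)
      -- The product of the two singletons is again a singleton of a thin element `x`; closedness of
      -- `G` puts `x` in `G`.
      with •-closed (proj₂ S) (proj₂ T)
    ... | x , (x-thin , _) , ST≐x = x , (x-thin , Closed.∙⊆ G-closed
            (∙-mono (λ y∈S → subst G (proj₁ S≐a y∈S) a∈G) (λ y∈T → subst G (proj₁ T≐b y∈T) b∈G)
              (proj₂ ST≐x refl))) , ST≐x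

  module _ {F : Pred Carrier ℓ} (F-sub : IsThinSubgroup ℍ F) where
    open IsThinSubgroup F-sub
    open IsSubgroup isSubgroup renaming (•-closed to F-•-closed)

    thinSubgroup-e∈ : e ∈ F
    thinSubgroup-e∈ with ε∈
    ... | a , a∈F , e≐a = subst F (sym (proj₂ e≐a refl)) a∈F

    private
      -- Packages `｛ a ｝` as an element of the group `thinγ ℍ`, so that closure of the subgroup can
      -- be applied to elements of `F`.
      singleton : ∀ {a} → a ∈ F →
        ∃ λ (S : RawMonoid.Carrier (thinγ ℍ)) → proj₁ S ≐ ｛ a ｝ × proj₁ S ∈ _^γ ℍ F
      singleton {a} a∈F =
        (｛ a ｝ , contained (a , a∈F , ≐-refl)) , ≐-refl , (a , a∈F , ≐-refl)

    thinSubgroup-∙⊆ : F ∙ F ⊆ F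
    thinSubgroup-∙⊆ (a , b , a∈F , b∈F , x∈ab)
      with singleton a∈F | singleton b∈F
    ... | S , S≐a , S∈ | T , T≐b , T∈ with F-•-closed {S} {T} S∈ T∈
    ...   | c , c∈F , ST≐c =
      subst F (proj₁ ST≐c (a , b , proj₂ S≐a refl , proj₂ T≐b refl , x∈ab)) c∈F

  -- The characterisation of strongly normal closed subsets, derived from five properties of `rr`.

  module Residue (r : Carrier)
    (r∈rr : r ∈ r · r)
    (rr-∙⊆ : (r · r) ∙ (r · r) ⊆ r · r)
    (square⊆rr : ∀ a → a · a ⊆ r · r)
    (rr∙thin : ∀ a → a ∈ (r · r) ∙ Thin ℍ)
    (rr∩thin : ∀ {a} → a ∈ r · r → Thin ℍ a → a ∈ ｛ e ｝)
    where

    R : Pred Carrier ℓ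
    R = r · r

    R-closed : IsClosed ℍ R
    R-closed = closed-if (e∈square r) rr-∙⊆

    R⊆closed : {K : Pred Carrier k} → IsClosed ℍ K → r ∈ K → R ⊆ K
    R⊆closed K-closed r∈K x∈rr = Closed.∙⊆ K-closed (r , r , r∈K , r∈K , x∈rr)

    ⟨r⟩≐R : ⟨_⟩ ℍ ｛ r ｝ ≐ R
    ⟨r⟩≐R = (λ x∈⟨r⟩ → x∈⟨r⟩ R R-closed λ { refl → r∈rr })
          , λ x∈R K K-closed r⊆K → R⊆closed K-closed (r⊆K refl) x∈R

    -- `R` is itself strongly normal in `⟨ X ⟩` because it contains all squares, and it is the least
    -- such subset because each one contains the square of `r`.
    O^ϑ≐R : (X : Pred Carrier g) → r ∈ ⟨_⟩ ℍ X → O^ϑ ℍ X ≐ R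
    O^ϑ≐R X r∈⟨X⟩ =
        (λ x∈O^ϑ → x∈O^ϑ R
          (stronglyNormal-if R-closed (R⊆closed (⟨⟩-closed X) r∈⟨X⟩) λ {a} _ → square⊆rr a))
      , λ x∈R K K-sn → square⊆stronglyNormal K-sn r∈⟨X⟩ x∈R

    O^ϑU≐R : O^ϑ ℍ U ≐ R
    O^ϑU≐R = O^ϑ≐R U (λ K _ U⊆K → U⊆K _)

    module _ {G : Pred Carrier ℓ} where

      module _ (G-sn : IsStronglyNormalClosedIn ℍ G U) where
        open IsStronglyNormalClosedIn G-sn

        R⊆G : R ⊆ G
        R⊆G = square⊆stronglyNormal G-sn _

        O^ϑG≐R : O^ϑ ℍ G ≐ R
        O^ϑG≐R = O^ϑ≐R G (λ K _ G⊆K → G⊆K (R⊆G r∈rr))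

        G≐R∙thin : G ≐ R ∙ O-thin ℍ G
        G≐R∙thin = to′ , Closed.∙⊆ isClosed ∘ ∙-mono R⊆G proj₂
          where
          to′ : G ⊆ R ∙ O-thin ℍ G
          -- With `x ∈ ts`, `t ∈ R` and `s` thin, exchange gives `s ∈ t*x`, which lies in `G` since
          -- `R ⊆ G`.
          to′ {x} x∈G with rr∙thin x
          ... | t , s , t∈R , s-thin , x∈ts = t , s , t∈R
            , ( s-thin , Closed.∙⊆ isClosed
                (t * , x , Closed.*∈ isClosed (R⊆G t∈R) , x∈G , exchangeʳ _ _ _ .to x∈ts))
            , x∈ts

      -- `(RF)(RF) = (RR)(FF) ⊆ RF` gives closedness; `e ∈ F` gives `R ⊆ RF`, so every square lies
      -- in `G`.
      R∙F⇒stronglyNormal : {F : Pred Carrier ℓ} → IsThinSubgroup ℍ F → G ≐ R ∙ F →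
                           IsStronglyNormalClosedIn ℍ G U
      R∙F⇒stronglyNormal {F} F-sub G≐RF =
        stronglyNormal-if
          (closed-if (R⊆G′ (e∈square r))
            ( proj₂ G≐RF ∘ ∙-mono rr-∙⊆ (thinSubgroup-∙⊆ F-sub)
            ∘ proj₁ (∙-interchange R F R F) ∘ ∙-mono (proj₁ G≐RF) (proj₁ G≐RF)))
          _ (λ {a} _ → R⊆G′ ∘ square⊆rr a)
        where
        R⊆G′ : R ⊆ G
        R⊆G′ {x} x∈R = proj₂ G≐RF (x , e , x∈R , thinSubgroup-e∈ F-sub , proj₂ (e-identityʳ x) refl)

    stronglyNormal⇔ : (G : Pred Carrier ℓ) →
      IsStronglyNormalClosedIn ℍ G U ⇔
      ((O^ϑ ℍ G ≐ O^ϑ ℍ U) ×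
       (O^ϑ ℍ U ≐ ⟨_⟩ ℍ ｛ r ｝) ×
       (∃ λ (F : Pred Carrier ℓ) →
          IsThinSubgroup ℍ F ×
          (G ≐ ⟨_⟩ ℍ ｛ r ｝ ∙ F) ×
          (⟨_⟩ ℍ ｛ r ｝ ∩ F ≐ ｛ e ｝) ×
          (O-thin ℍ G ≐ F)))
    stronglyNormal⇔ G = mk⇔
      (λ G-sn → let G-closed = IsStronglyNormalClosedIn.isClosed G-sn in
          ≐-trans (O^ϑG≐R G-sn) (≐-sym O^ϑU≐R)
        , ≐-trans O^ϑU≐R (≐-sym ⟨r⟩≐R)
        -- The witness for `F` is forced: it is the thin part of `G`.
        , O-thin ℍ G
        , thinSubgroup G-closed
        , ≐-trans (G≐R∙thin G-sn) (∙-mono (proj₂ ⟨r⟩≐R) id , ∙-mono (proj₁ ⟨r⟩≐R) id)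
        , ( (λ { (x∈⟨r⟩ , x-thin , _) → rr∩thin (proj₁ ⟨r⟩≐R x∈⟨r⟩) x-thin })
          , λ { refl → proj₂ ⟨r⟩≐R (e∈square r) , e-thin , Closed.e∈ G-closed })
        , ≐-refl)
      λ { (_ , _ , F , F-sub , G≐⟨r⟩F , _) →
          R∙F⇒stronglyNormal F-sub
            (≐-trans G≐⟨r⟩F (∙-mono (proj₁ ⟨r⟩≐R) id , ∙-mono (proj₂ ⟨r⟩≐R) id)) }

-- Self-inverseness and componentwise squares in an elementary abelian 2-hypergroup.

module ElementaryAbelian (ℍ : Hypergroup ℓ) (q : Vector (Hypergroup.Carrier ℍ) (suc n))
  (elementary : IsElementaryAbelian2Hypergroup ℍ q) where
  open Hypergroup ℍ
  open ThinProducts ℍ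
  open HypergroupProperties ℍ
  open IsElementaryAbelian2Hypergroup elementary
  open IsDirectProduct isDirectProduct using (isNormal; generate)
  open IsDecomposition

  ∈⟨q⟩ : ∀ i → generated ℍ q i ≐ ｛ e ｝ ∪ ｛ q i ｝
  ∈⟨q⟩ i = ⟨involution⟩ (isInvolution i)

  decompose : ∀ x → ∃ (IsDecomposition ℍ (generated ℍ q) x)
  -- Removing index `zero` leaves the tail, so `generate zero` speaks of the full ordered product.
  decompose x = ∏-select (proj₁ (generate zero) _)

  factor-self-inverse : ∀ i {a} → a ∈ generated ℍ q i → a * ≡ a
  factor-self-inverse i a∈ with proj₁ (∈⟨q⟩ i) a∈
  ... | inj₁ refl = e*≡e
  ... | inj₂ refl = involution-self-inverse (isInvolution i)

  factors-commute : ∀ i j {a b} → a ∈ generated ℍ q i → b ∈ generated ℍ q j → a · b ⊆ b · a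
  factors-commute i j {a} {b} a∈ b∈ x∈ab with proj₁ (∈⟨q⟩ i) a∈ | proj₁ (∈⟨q⟩ j) b∈
  ... | inj₁ refl | _         = proj₂ (e-identityʳ b) (proj₁ (e-identityˡ b) x∈ab)
  ... | inj₂ refl | inj₁ refl = proj₂ (e-identityˡ a) (proj₁ (e-identityʳ a) x∈ab)
  ... | inj₂ refl | inj₂ refl =
    involutions-commute (isInvolution i) (isInvolution j) (isNormal i) x∈ab

  -- The product of the components of `x` contains `x *` along with `x`, and being constrained it is
  -- the singleton `｛ x ｝`.
  *-id : ∀ x → x * ≡ x
  *-id x with decompose x
  ... | v , d = sym (proj₁ (isConstrained x v d) (∏-self-inverse
    (λ i → factor-self-inverse i (component d i))
    (λ i j → factors-commute i j (component d i) (component d j))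
    (product d)))

  open SelfInverse ℍ *-id public

  -- Constrainedness replaces each `｛ x ｝` by the product of the `｛ v i ｝`; the two products are
  -- then interleaved.
  square≐∏ : ∀ {x v} → IsDecomposition ℍ (generated ℍ q) x v →
             x · x ≐ ∏ ℍ (λ i → v i · v i)
  square≐∏ {x} {v} d =
    ≐-trans (≐-sym (｛a｝∙｛b｝≐ab x x))
    (≐-trans (≐-sym (CommutativeMonoid.∙-cong ∙-commutativeMonoid x≐∏ x≐∏))
    (≐-trans (≐-sym (∏-distrib-∙ (map ｛_｝ v) (map ｛_｝ v)))
    ( ∏-mono {F = λ i → ｛ v i ｝ ∙ ｛ v i ｝} {G = λ i → v i · v i}
        (λ i → proj₁ (｛a｝∙｛b｝≐ab (v i) (v i)))
    , ∏-mono {F = λ i → v i · v i} {G = λ i → ｛ v i ｝ ∙ ｛ v i ｝}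
        (λ i → proj₂ (｛a｝∙｛b｝≐ab (v i) (v i))))))
    where
    x≐∏ : ∏ ℍ (map ｛_｝ v) ≐ ｛ x ｝
    x≐∏ = isConstrained x v d

  factor-square⊆ : ∀ i {a} → a ∈ generated ℍ q i → a · a ⊆ ｛ e ｝ ∪ ｛ a ｝
  factor-square⊆ i a∈ x∈aa with proj₁ (∈⟨q⟩ i) a∈
  ... | inj₁ refl = inj₁ (proj₁ (e-identityˡ e) x∈aa)
  ... | inj₂ refl = Closed.∙⊆ (IsInvolution.isClosed (isInvolution i))
    (_ , _ , inj₂ refl , inj₂ refl , x∈aa)

  -- The square of the element supported on the thick involutions.

  module ThickSupport (em : ExcludedMiddle ℓ) (r : Carrier)
    (support-r : Support ℍ (generated ℍ q) r ≐ (Thick ℍ ∩ λ x → ∃ λ i → x ≡ q i)) where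

    -- Since `aa ⊆ {e , a}`, omitting `a` would leave `aa = {e}` and make `a` thin.
    thick-idempotent : ∀ i {a} → a ∈ generated ℍ q i → Thick ℍ a → a ∈ a · a
    thick-idempotent i {a} a∈ a-thick with em {P = a ∈ a · a}
    ... | yes a∈aa = a∈aa
    ... | no  a∉aa = ⊥-elim (a-thick (square-thin (aa⊆e , λ { refl → e∈square a })))
      where
      aa⊆e : a · a ⊆ ｛ e ｝
      aa⊆e x∈aa with factor-square⊆ i a∈ x∈aa
      ... | inj₁ e≡x  = e≡x
      ... | inj₂ refl = ⊥-elim (a∉aa x∈aa)

    -- The decomposition of `r` is a parameter because two occur: the one chosen by `decompose`, and
    -- the one carried by `support-r` in `thick⇒∈rr`.
    module Factors {v : Vector Carrier (suc n)}
                   (d : IsDecomposition ℍ (generated ℍ q) r v) where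

      -- A component is either `e` or some `q i`; in the latter case it belongs to the support of
      -- `r` and is therefore thick.
      factor-idempotent : ∀ i → v i ∈ v i · v i
      factor-idempotent i with proj₁ (∈⟨q⟩ i) (component d i)
      ... | inj₁ e≡vᵢ  = subst (λ a → a ∈ a · a) e≡vᵢ (proj₂ (e-identityˡ e) refl)
      ... | inj₂ qᵢ≡vᵢ = thick-idempotent i (component d i) (proj₁ (proj₁ support-r
        (v , d , (i , refl) , subst (_≢ e) qᵢ≡vᵢ (IsInvolution.a≢e (isInvolution i)))))

      factor-square : ∀ i → v i · v i ⊆ ｛ e ｝ ∪ ｛ v i ｝
      factor-square i = factor-square⊆ i (component d i)

      factor-square-idempotent : ∀ i {a} → a ∈ v i · v i → a ∈ a · a
      factor-square-idempotent i {a} a∈ with factor-square i a∈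
      ... | inj₁ e≡a  = subst (λ a → a ∈ a · a) e≡a (proj₂ (e-identityˡ e) refl)
      ... | inj₂ vᵢ≡a = subst (λ a → a ∈ a · a) vᵢ≡a (factor-idempotent i)

      -- Both elements multiplied are `e` or `v i`: a factor `e` changes nothing, and `v i` times
      -- `v i` is the set itself.
      factor-square-∙⊆ : ∀ i → (v i · v i) ∙ (v i · v i) ⊆ v i · v i
      factor-square-∙⊆ i (a , b , a∈ , b∈ , x∈ab) with factor-square i a∈ | factor-square i b∈
      ... | inj₁ refl | _         = subst (_∈ v i · v i) (proj₁ (e-identityˡ b) x∈ab) b∈
      ... | inj₂ refl | inj₁ refl = subst (_∈ v i · v i) (proj₁ (e-identityʳ a) x∈ab) a∈
      ... | inj₂ refl | inj₂ refl = x∈ab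

      r∈rr : r ∈ r · r
      r∈rr = proj₂ (square≐∏ d) (∏-mono {F = map ｛_｝ v} {G = λ i → v i · v i}
        (λ { i refl → factor-idempotent i }) (product d))

      rr-∙⊆ : (r · r) ∙ (r · r) ⊆ r · r
      rr-∙⊆ =
          proj₂ (square≐∏ d)
        ∘ ∏-mono {F = λ i → (v i · v i) ∙ (v i · v i)} {G = λ i → v i · v i} factor-square-∙⊆
        ∘ proj₂ (∏-distrib-∙ (λ i → v i · v i) (λ i → v i · v i))
        ∘ ∙-mono (proj₁ (square≐∏ d)) (proj₁ (square≐∏ d))

      -- Write x = ∏ uᵢ with uᵢ ∈ vᵢvᵢ; each uᵢ is idempotent, so x ∈ ∏ uᵢuᵢ = xx = {e}.
      rr∩thin : ∀ {x} → x ∈ r · r → Thin ℍ x → x ∈ ｛ e ｝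
      rr∩thin {x} x∈rr x-thin = proj₁ (thin-square x-thin)
        (proj₂ (square≐∏ x≐∏u) (∏-mono {F = map ｛_｝ u} {G = λ i → u i · u i}
          (λ { i refl → factor-square-idempotent i (component u-decomposition i) })
          (product u-decomposition)))
        where
        selection : ∃ (IsDecomposition ℍ (λ i → v i · v i) x)
        selection = ∏-select (proj₁ (square≐∏ d) x∈rr)

        u : Vector Carrier (suc n)
        u = proj₁ selection

        u-decomposition : IsDecomposition ℍ (λ i → v i · v i) x u
        u-decomposition = proj₂ selection

        -- As `vᵢvᵢ ⊆ ⟨ ｛ q i ｝ ⟩`, the selection `u` also decomposes `x` along the original
        -- factors, so `square≐∏` applies to it.
        x≐∏u : IsDecomposition ℍ (generated ℍ q) x u
        x≐∏u = record
          { component = λ i → Closed.∙⊆ (⟨⟩-closed ｛ q i ｝)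
              (v i , v i , component d i , component d i , component u-decomposition i)
          ; product = product u-decomposition
          }

    open Factors (proj₂ (decompose r)) public using (r∈rr; rr-∙⊆; rr∩thin)

    -- A thick `q i` is in the support, hence equals a component `v j` of `r`; being idempotent it
    -- lies in `vⱼvⱼ`, one of the factors of `rr`.
    thick⇒∈rr : ∀ i → Thick ℍ (q i) → q i ∈ r · r
    thick⇒∈rr i qᵢ-thick with proj₂ support-r (qᵢ-thick , i , refl)
    ... | v , d , (j , qᵢ≡vⱼ) , _ = subst (_∈ r · r) (sym qᵢ≡vⱼ)
      (proj₂ (square≐∏ d) (factor⊆∏ {F = λ k → v k · v k} (λ k → e∈square (v k)) j
        (Factors.factor-idempotent d j)))

    -- The elements whose square lies in rr are closed under products, so it
    -- suffices to check the generators; likewise for rr ∙ Thin below.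
    square⊆rr : ∀ a → a · a ⊆ r · r
    square⊆rr a = ∏-closed {F = generated ℍ q} {K = λ b → b · b ⊆ r · r}
        e-square product-square generator
        (proj₁ (generate zero) {a} _)
      where
      e-square : e · e ⊆ r · r
      e-square x∈ee with proj₁ (e-identityˡ e) x∈ee
      ... | refl = e∈square r

      -- For `x ∈ bc`, interchange gives `xx ⊆ (bc)(bc) = (bb)(cc)`.
      product-square : (λ b → b · b ⊆ r · r) ∙ (λ b → b · b ⊆ r · r) ⊆ (λ b → b · b ⊆ r · r)
      product-square (b , c , bb⊆rr , cc⊆rr , x∈bc) =
          rr-∙⊆
        ∘ ∙-mono (bb⊆rr ∘ proj₁ (｛a｝∙｛b｝≐ab b b)) (cc⊆rr ∘ proj₁ (｛a｝∙｛b｝≐ab c c))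
        ∘ proj₁ (∙-interchange ｛ b ｝ ｛ c ｝ ｛ b ｝ ｛ c ｝)
        ∘ λ y∈xx → _ , _ , (b , c , refl , refl , x∈bc) , (b , c , refl , refl , x∈bc) , y∈xx

      generator : ∀ i → generated ℍ q i ⊆ (λ b → b · b ⊆ r · r)
      generator i b∈ x∈bb with proj₁ (∈⟨q⟩ i) b∈
      ... | inj₁ refl = e-square x∈bb
      ... | inj₂ refl with em {P = Thin ℍ (q i)}
      ...   | yes qᵢ-thin = subst (_∈ r · r) (proj₁ (thin-square qᵢ-thin) x∈bb) (e∈square r)
      ...   | no qᵢ-thick with factor-square⊆ i b∈ x∈bb
      ...     | inj₁ refl = e∈square r
      ...     | inj₂ refl = thick⇒∈rr i qᵢ-thick

    rr∙thin : ∀ a → a ∈ (r · r) ∙ Thin ℍ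
    rr∙thin a = ∏-closed {F = generated ℍ q} {K = (r · r) ∙ Thin ℍ} e∈
        (∙-mono rr-∙⊆ thin-∙⊆ ∘ proj₁ (∙-interchange (r · r) (Thin ℍ) (r · r) (Thin ℍ)))
        generator (proj₁ (generate zero) {a} _)
      where
      e∈ : e ∈ (r · r) ∙ Thin ℍ
      e∈ = e , e , e∈square r , e-thin , proj₂ (e-identityˡ e) refl

      generator : ∀ i → generated ℍ q i ⊆ (r · r) ∙ Thin ℍ
      generator i b∈ with proj₁ (∈⟨q⟩ i) b∈
      ... | inj₁ refl = e∈
      -- A thin generator goes wholly into the `Thin` factor and a thick one wholly into `rr`, with
      -- `e` as the other factor.
      ... | inj₂ refl with em {P = Thin ℍ (q i)}
      ...   | yes qᵢ-thin = e , q i , e∈square r , qᵢ-thin , proj₂ (e-identityˡ _) refl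
      ...   | no qᵢ-thick = q i , e , thick⇒∈rr i qᵢ-thick , e-thin , proj₂ (e-identityʳ _) refl

theorem3p13 : {ℓ : Level} → ExcludedMiddle ℓ →
    (ℍ : Hypergroup ℓ) → let open Hypergroup ℍ in
    (n : ℕ) (q : Vector Carrier (suc n)) →
    IsElementaryAbelian2Hypergroup ℍ q →
    (G : Pred Carrier ℓ) (r : Carrier) →
    Support ℍ (generated ℍ q) r ≐ (Thick ℍ ∩ λ x → ∃ λ i → x ≡ q i) →
    IsElementaryAbelian2Group (thinγ ℍ) ×
    (IsStronglyNormalClosedIn ℍ G U ⇔
    ((O^ϑ ℍ G ≐ O^ϑ ℍ U) ×
    (O^ϑ ℍ U ≐ ⟨_⟩ ℍ ｛ r ｝) ×
    (∃ λ (F : Pred Carrier ℓ) →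
    IsThinSubgroup ℍ F ×
    (G ≐ ⟨_⟩ ℍ ｛ r ｝ ∙ F) ×
    (⟨_⟩ ℍ ｛ r ｝ ∩ F ≐ ｛ e ｝) ×
    (O-thin ℍ G ≐ F))))
theorem3p13 em ℍ n q elementary G r support-r =
  thinγ-elementary , Residue.stronglyNormal⇔ r r∈rr rr-∙⊆ square⊆rr rr∙thin rr∩thin G
  where
  open ElementaryAbelian ℍ q elementary
  open ThickSupport em r support-r
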